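{- The conflict-free closed neighborhood (CF-CN) coloring problem is polynomial time solvable on the class of split graphs: there is a polynomial-time algorithm that, given a finite simple connected undirected split graph $G$ and an integer $k$, decides whether $G$ has a CF-CN coloring $V(G)\to\{1,\dots,k\}$.
   Context: A split graph is a graph whose vertex set can be partitioned into a clique and an independent set. Let $N[v]$ be the closed neighborhood of $v$. For a coloring $C_G:V(G)\to\{1,\dots,k\}$ (not necessarily proper), a set $U\subseteq V(G)$ has a unique color if there is a color $c$ with $|\{u\in U: C_G(u)=c\}|=1$. The coloring is a conflict-free closed neighborhood (CF-CN) coloring if $N[v]$ has a unique color for every $v\in V(G)$. -}

module Defs where

open import Data.Bool.Base using (Bool; true; false; if_then_else_)
open import Data.Fin.Base using (Fin; fromℕ<; remQuot)
open import Data.Fin.Subset using (Subset; _∈_; ⁅_⁆; ∁; _∩_; _∪_; ∣_∣)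
open import Data.Integer.Base as ℤ using (ℤ; 1ℤ)
import Data.Integer.Properties as ℤ
open import Data.Nat.Base using (ℕ; suc; _+_; _*_; _∸_; _^_; _≤_; _<_)
open import Data.Nat.Logarithm using (⌈log₂_⌉)
open import Data.Nat.Properties using (_≟_; _<?_)
open import Data.Product.Base using (Σ; ∃; _×_; _,_; uncurry)
open import Data.Sign.Base as Sign using (Sign)
open import Data.Vec.Base using (tabulate)
open import Relation.Binary.Construct.Closure.ReflexiveTransitive using (Star)
open import Relation.Binary.PropositionalEquality.Core using (_≡_; _≢_)
open import Relation.Nullary.Decidable.Core using (yes; no; does)
open import Relation.Nullary.Negation.Core using (¬_)
open import Relation.Nullary.Reflects using (Reflects)

------------------------------------------------------------------------
-- Graphs

record Graph (n : ℕ) : Set where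
  field
    adj    : Fin n → Fin n → Bool
    symm   : ∀ u v → adj u v ≡ adj v u
    irrefl : ∀ v → adj v v ≡ false

open Graph public

Adj : ∀ {n} → Graph n → Fin n → Fin n → Set
Adj G u v = adj G u v ≡ true

IsClique : ∀ {n} → Graph n → Subset n → Set
IsClique G K = ∀ u v → u ∈ K → v ∈ K → u ≢ v → Adj G u v

IsIndependent : ∀ {n} → Graph n → Subset n → Set
IsIndependent G I = ∀ u v → u ∈ I → v ∈ I → ¬ Adj G u v

IsSplit : ∀ {n} → Graph n → Set
IsSplit G = ∃ λ K → IsClique G K × IsIndependent G (∁ K)

-- As usual, a connected graph has at least one vertex.
IsConnected : ∀ {n} → Graph n → Set
IsConnected {n} G = 0 < n × (∀ u v → Star (Adj G) u v)

N[_,_] : ∀ {n} → Graph n → Fin n → Subset n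
N[ G , v ] = ⁅ v ⁆ ∪ tabulate (adj G v)

------------------------------------------------------------------------
-- Conflict-free closed neighbourhood colorings

colorClass : ∀ {n} → (Fin n → ℤ) → ℤ → Subset n
colorClass C c = tabulate λ u → does (C u ℤ.≟ c)

HasUniqueColor : ∀ {n} → (Fin n → ℤ) → Subset n → Set
HasUniqueColor C U = ∃ λ c → ∣ U ∩ colorClass C c ∣ ≡ 1

-- The palette is {1, …, k} for an arbitrary integer k; it is empty if k ≤ 0.
IsColoring : ∀ {n} → ℤ → (Fin n → ℤ) → Set
IsColoring k C = ∀ v → 1ℤ ℤ.≤ C v × C v ℤ.≤ k

IsCFCN : ∀ {n} → Graph n → (Fin n → ℤ) → Set
IsCFCN G C = ∀ v → HasUniqueColor C N[ G , v ]

CFCNColorable : ∀ {n} → Graph n → ℤ → Set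
CFCNColorable G k = ∃ λ C → IsColoring k C × IsCFCN G C

------------------------------------------------------------------------
-- Random access machines
--
-- A RAM with while-programs as control structure: registers and a
-- memory, both indexed by ℕ and holding natural numbers, where only the
-- memory can be addressed indirectly.  Every operation costs one unit.
-- As the only arithmetic is addition and truncated subtraction, the bit
-- length of the largest number involved (constants of the program
-- included) grows by at most one per unit of time, so polynomial time
-- here agrees with polynomial time on Turing machines.

data Expr : Set where
  num     : ℕ → Expr
  reg     : ℕ → Expr
  mem     : Expr → Expr
  _⊕_ _⊖_ : Expr → Expr → Expr

infixl 6 _⊕_ _⊖_

data Cmd : Set where
  skip            : Cmd
  _≔_             : ℕ → Expr → Cmd
  mem[_]≔_        : Expr → Expr → Cmd
  _⨾_             : Cmd → Cmd → Cmd
  if≢0_then_else_ : Expr → Cmd → Cmd → Cmd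
  while≢0_loop_   : Expr → Cmd → Cmd

infix  5 _≔_ mem[_]≔_
infixr 4 _⨾_
infix  5 if≢0_then_else_ while≢0_loop_

record State : Set where
  constructor ⟪_,_⟫
  field
    regs   : ℕ → ℕ
    memory : ℕ → ℕ

open State public

_[_↦_] : (ℕ → ℕ) → ℕ → ℕ → ℕ → ℕ
(f [ i ↦ x ]) j = if does (j ≟ i) then x else f j

⟦_⟧ : Expr → State → ℕ
⟦ num m ⟧ s = m
⟦ reg i ⟧ s = regs s i
⟦ mem e ⟧ s = memory s (⟦ e ⟧ s)
⟦ e ⊕ f ⟧ s = ⟦ e ⟧ s + ⟦ f ⟧ s
⟦ e ⊖ f ⟧ s = ⟦ e ⟧ s ∸ ⟦ f ⟧ s

cost : Expr → ℕ
cost (num m) = 1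
cost (reg i) = 1
cost (mem e) = suc (cost e)
cost (e ⊕ f) = suc (cost e + cost f)
cost (e ⊖ f) = suc (cost e + cost f)

-- ⟨ c , s ⟩⇓[ t ] s′: started in s, the program c halts in s′ after
-- exactly t units of time.
data ⟨_,_⟩⇓[_]_ : Cmd → State → ℕ → State → Set where

  skip : ∀ {s} → ⟨ skip , s ⟩⇓[ 1 ] s

  assign : ∀ {i e s} →
    ⟨ i ≔ e , s ⟩⇓[ suc (cost e) ] ⟪ regs s [ i ↦ ⟦ e ⟧ s ] , memory s ⟫

  store : ∀ {e f s} →
    ⟨ mem[ e ]≔ f , s ⟩⇓[ suc (cost e + cost f) ]
      ⟪ regs s , memory s [ ⟦ e ⟧ s ↦ ⟦ f ⟧ s ] ⟫

  seq : ∀ {c d s s′ s″ t t′} →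
    ⟨ c , s ⟩⇓[ t ] s′ → ⟨ d , s′ ⟩⇓[ t′ ] s″ →
    ⟨ c ⨾ d , s ⟩⇓[ t + t′ ] s″

  if-then : ∀ {e c d s s′ t} → ⟦ e ⟧ s ≢ 0 →
    ⟨ c , s ⟩⇓[ t ] s′ →
    ⟨ if≢0 e then c else d , s ⟩⇓[ suc (cost e + t) ] s′

  if-else : ∀ {e c d s s′ t} → ⟦ e ⟧ s ≡ 0 →
    ⟨ d , s ⟩⇓[ t ] s′ →
    ⟨ if≢0 e then c else d , s ⟩⇓[ suc (cost e + t) ] s′

  while-do : ∀ {e c s s′ s″ t t′} → ⟦ e ⟧ s ≢ 0 →
    ⟨ c , s ⟩⇓[ t ] s′ → ⟨ while≢0 e loop c , s′ ⟩⇓[ t′ ] s″ →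
    ⟨ while≢0 e loop c , s ⟩⇓[ suc (cost e + (t + t′)) ] s″

  while-end : ∀ {e c s} → ⟦ e ⟧ s ≡ 0 →
    ⟨ while≢0 e loop c , s ⟩⇓[ suc (cost e) ] s

------------------------------------------------------------------------
-- Polynomial-time decidability

bit : Bool → ℕ
bit b = if b then 1 else 0

-- A decision problem, to be solved on the instances in a given class.
record Problem : Set₁ where
  field
    Instance : Set
    size     : Instance → ℕ
    input    : Instance → State
    InClass  : Instance → Set
    Yes      : Instance → Set

-- One program answers every instance of the class, in register 0, within
-- time polynomial in the size of the instance.
PolyTimeSolvable : Problem → Set
PolyTimeSolvable P =
  Σ Cmd λ prog → Σ ℕ λ a → Σ ℕ λ d → Σ ℕ λ b →
    ∀ x → InClass x →
      ∃ λ t → ∃ λ s → ∃ λ answer →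
        ⟨ prog , input x ⟩⇓[ t ] s ×
        t ≤ a * size x ^ d + b ×
        regs s 0 ≡ bit answer ×
        Reflects (Yes x) answer
  where open Problem P

------------------------------------------------------------------------
-- The CF-CN coloring problem on a class of graphs

-- Row-major adjacency matrix: entry (u , v) is at address n * u + v.
adjacencyMatrix : ∀ {n} → Graph n → ℕ → ℕ
adjacencyMatrix {n} G i with i <? n * n
... | yes i<n*n = bit (uncurry (adj G) (remQuot n (fromℕ< i<n*n)))
... | no  _     = 0

signBit : Sign → ℕ
signBit Sign.+ = 0
signBit Sign.- = 1

-- Registers 0, 1 and 2 hold n and the sign and absolute value of k.
inputRegs : ℕ → ℤ → ℕ → ℕ
inputRegs n k 0 = n
inputRegs n k 1 = signBit (ℤ.sign k)
inputRegs n k 2 = ℤ.∣ k ∣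
inputRegs n k _ = 0

CFCNColoring : (∀ {n} → Graph n → Set) → Problem
CFCNColoring Class = record
  { Instance = ∃ Graph × ℤ
  -- n² bits for the matrix, one for the sign of k, and the binary
  -- length ⌈log₂ (1 + ∣k∣)⌉ of its absolute value.
  ; size     = λ ((n , G) , k) → n * n + suc ⌈log₂ suc ℤ.∣ k ∣ ⌉
  ; input    = λ ((n , G) , k) → ⟪ inputRegs n k , adjacencyMatrix G ⟫
  ; InClass  = λ ((n , G) , k) → Class G
  ; Yes      = λ ((n , G) , k) → CFCNColorable G k
  }

{-# OPTIONS --safe #-}
module Submission where

-- For k ≤ 0 there is no coloring, for k = 1 there is one iff n = 1, and for
-- k ≥ 3 there always is one.  For k = 2, a connected split graph is colorable
-- iff for some vertices w and z the set N[w] ∖ {z} and its complement are the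
-- classes of a conflict-free coloring: if u is universal then w = z = u works;
-- otherwise either the clique K is monochromatic and equals N[w] ∖ {z}, with z
-- the only neighbor of w outside K, or G is a double star, and w = z is one of
-- its centers.  This criterion is a first-order sentence in the adjacency
-- relation, and every fixed first-order sentence is evaluated in polynomial
-- time by nested loops over the vertices.

open import Defs
open import Data.Bool.Base using (Bool; true; false; not; _∧_; _∨_; if_then_else_)
import Data.Bool.Properties as Bool
open import Data.Fin.Base using (Fin; zero; suc; toℕ; fromℕ<; inject≤; combine; remQuot)
open import Data.Fin.Properties as Fin
  using (any?; all?; ¬∀⟶∃¬; toℕ-fromℕ<; toℕ<n; toℕ-injective; inject≤-injective;
         remQuot-combine; toℕ-combine)
open import Data.Fin.Subset using (Subset; _∈_; _∉_; ⁅_⁆; ∁; _∩_; ∣_∣)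
open import Data.Fin.Subset.Properties
  using (_∈?_; nonempty?; Empty-unique; ∣⊥∣≡0; ∣⁅x⁆∣≡1; x∈⁅x⁆; x∈⁅y⁆⇒x≡y; ⊆-antisym;
         p⊂q⇒∣p∣<∣q∣; x∈p∩q⁺; x∈p∩q⁻; x∈p∪q⁺; x∈p∪q⁻; x∉p⇒x∈∁p)
open import Data.Integer.Base as ℤ using (ℤ; +_; -[1+_])
import Data.Integer.Properties as ℤ
open import Data.Nat.Base using (ℕ; zero; suc; _+_; _*_; _∸_; _^_; _≤_; _<_; z≤n; s≤s)
import Data.Nat.Properties as ℕ
open import Data.Product.Base using (∃; ∃₂; _×_; _,_; proj₁; proj₂; uncurry)
open import Data.Sum.Base using (_⊎_; inj₁; inj₂; [_,_]′)
open import Data.Vec.Base using (Vec; []; _∷_; lookup; tabulate)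
open import Data.Vec.Properties using (lookup∘tabulate; lookup⇒[]=; []=⇒lookup)
open import Function.Base using (_∘_; id)
open import Relation.Binary.Construct.Closure.ReflexiveTransitive using (ε; _◅_)
open import Relation.Binary.Definitions using (tri<; tri≈; tri>)
open import Relation.Binary.PropositionalEquality
open import Relation.Nullary.Decidable
  using (Dec; yes; no; does; proof; ¬?; _×-dec_; _⊎-dec_; dec-true; dec-false; decidable-stable)
open import Relation.Nullary.Negation using (¬_; contradiction)
open import Relation.Nullary.Reflects
  using (Reflects; ofʸ; ofⁿ; ¬-reflects; _×-reflects_; _⊎-reflects_; _→-reflects_)

private variable
  n m : ℕ

-- Conflict-free colorings as colorings by relations

infix 4 _∈N[_,_]

_∈N[_,_] : Fin n → Graph n → Fin n → Set
x ∈N[ G , v ] = x ≡ v ⊎ Adj G v x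

∈N-dec : ∀ (G : Graph n) x v → Dec (x ∈N[ G , v ])
∈N-dec G x v = (x Fin.≟ v) ⊎-dec (adj G v x Bool.≟ true)

Adj-sym : ∀ (G : Graph n) {u v} → Adj G u v → Adj G v u
Adj-sym G {u} {v} uv = trans (symm G v u) uv

Adj⇒≢ : ∀ (G : Graph n) {u v} → Adj G u v → u ≢ v
Adj⇒≢ G {u} uv refl with () ← trans (sym uv) (irrefl G u)

∈N-sym : ∀ (G : Graph n) {u v} → u ∈N[ G , v ] → v ∈N[ G , u ]
∈N-sym G (inj₁ u≡v) = inj₁ (sym u≡v)
∈N-sym G (inj₂ vu)  = inj₂ (Adj-sym G vu)

-- The relation stands for "having the same color".
ConflictFree : Graph n → (Fin n → Fin n → Set) → Set
ConflictFree G _∼_ =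
  ∀ v → ∃ λ x → x ∈N[ G , v ] × (∀ y → y ∈N[ G , v ] → y ∼ x → y ≡ x)

-- Shrinking the relation only strengthens the premise of the uniqueness clause, so the same witness
-- x serves. This is how palettes are exchanged and how colorings are compared with the sets N[w] ∖
-- {z}.
ConflictFree-refine : ∀ (G : Graph n) {R S : Fin n → Fin n → Set} →
  (∀ y x → S y x → R y x) → ConflictFree G R → ConflictFree G S
ConflictFree-refine G S⇒R cf v with cf v
... | x , x∈ , uniq = x , x∈ , λ y y∈ → uniq y y∈ ∘ S⇒R y x

SameColor : ∀ {A : Set} → (Fin n → A) → Fin n → Fin n → Set
SameColor f y x = f y ≡ f x

Colorable : Graph n → ℕ → Set
Colorable {n} G m = ∃ λ (f : Fin n → Fin m) → ConflictFree G (SameColor f)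

-- A second element would make `⁅ x ⁆` a proper subset of p, hence of smaller cardinality.
∣p∣≡1⇒singleton : ∀ (p : Subset n) → ∣ p ∣ ≡ 1 → ∃ λ x → x ∈ p × (∀ y → y ∈ p → y ≡ x)
∣p∣≡1⇒singleton {n} p ∣p∣≡1 with nonempty? p
... | no empty with () ← trans (sym ∣p∣≡1) (trans (cong ∣_∣ (Empty-unique empty)) (∣⊥∣≡0 n))
... | yes (x , x∈p) = x , x∈p , λ y y∈p → decidable-stable (y Fin.≟ x) λ y≢x →
  ℕ.<-irrefl (trans (∣⁅x⁆∣≡1 x) (sym ∣p∣≡1))
    (p⊂q⇒∣p∣<∣q∣ ((λ z∈ → subst (_∈ p) (sym (x∈⁅y⁆⇒x≡y x z∈)) x∈p) ,
                   y , y∈p , y≢x ∘ x∈⁅y⁆⇒x≡y x))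

singleton⇒∣p∣≡1 : ∀ (p : Subset n) x → x ∈ p → (∀ y → y ∈ p → y ≡ x) → ∣ p ∣ ≡ 1
singleton⇒∣p∣≡1 p x x∈p uniq = trans (cong ∣_∣ p≡⁅x⁆) (∣⁅x⁆∣≡1 x)
  where
  p≡⁅x⁆ : p ≡ ⁅ x ⁆
  p≡⁅x⁆ = ⊆-antisym (λ {y} y∈ → subst (_∈ ⁅ x ⁆) (sym (uniq y y∈)) (x∈⁅x⁆ x))
                    (λ {y} y∈ → subst (_∈ p) (sym (x∈⁅y⁆⇒x≡y x y∈)) x∈p)

∈-tabulate⁺ : ∀ (f : Fin n → Bool) {x} → f x ≡ true → x ∈ tabulate f
∈-tabulate⁺ f {x} fx = lookup⇒[]= x (tabulate f) (trans (lookup∘tabulate f x) fx)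

∈-tabulate⁻ : ∀ (f : Fin n → Bool) {x} → x ∈ tabulate f → f x ≡ true
∈-tabulate⁻ f {x} x∈ = trans (sym (lookup∘tabulate f x)) ([]=⇒lookup x∈)

∈N⇒∈ : ∀ (G : Graph n) {x v} → x ∈N[ G , v ] → x ∈ N[ G , v ]
∈N⇒∈ G (inj₁ refl) = x∈p∪q⁺ (inj₁ (x∈⁅x⁆ _))
∈N⇒∈ G (inj₂ vx)   = x∈p∪q⁺ (inj₂ (∈-tabulate⁺ _ vx))

∈⇒∈N : ∀ (G : Graph n) {x v} → x ∈ N[ G , v ] → x ∈N[ G , v ]
∈⇒∈N G {v = v} x∈ with x∈p∪q⁻ ⁅ v ⁆ _ x∈
... | inj₁ x∈ = inj₁ (x∈⁅y⁆⇒x≡y v x∈)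
... | inj₂ x∈ = inj₂ (∈-tabulate⁻ _ x∈)

∈-colorClass⁺ : ∀ (C : Fin n → ℤ) {c x} → C x ≡ c → x ∈ colorClass C c
∈-colorClass⁺ C {c} {x} Cx≡c = ∈-tabulate⁺ _ (dec-true (C x ℤ.≟ c) Cx≡c)

∈-colorClass⁻ : ∀ (C : Fin n → ℤ) {c x} → x ∈ colorClass C c → C x ≡ c
∈-colorClass⁻ C {c} {x} x∈ with C x ℤ.≟ c | ∈-tabulate⁻ (λ u → does (C u ℤ.≟ c)) x∈
... | yes Cx≡c | _ = Cx≡c
... | no _     | ()

CFCN⇒ConflictFree : ∀ (G : Graph n) {C} → IsCFCN G C → ConflictFree G (SameColor C)
CFCN⇒ConflictFree G {C} cf v with cf v
... | c , ∣∣≡1 with ∣p∣≡1⇒singleton (N[ G , v ] ∩ colorClass C c) ∣∣≡1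
... | x , x∈ , uniq with x∈p∩q⁻ N[ G , v ] _ x∈
... | x∈N , x∈c = x , ∈⇒∈N G x∈N , λ y y∈N Cy≡Cx →
  uniq y (x∈p∩q⁺ (∈N⇒∈ G y∈N , ∈-colorClass⁺ C (trans Cy≡Cx (∈-colorClass⁻ C x∈c))))

ConflictFree⇒CFCN : ∀ (G : Graph n) {C} → ConflictFree G (SameColor C) → IsCFCN G C
ConflictFree⇒CFCN G {C} cf v with cf v
... | x , x∈ , uniq = C x , singleton⇒∣p∣≡1 (N[ G , v ] ∩ colorClass C (C x)) x
  (x∈p∩q⁺ (∈N⇒∈ G x∈ , ∈-colorClass⁺ C refl))
  λ y y∈ → let y∈N , y∈c = x∈p∩q⁻ N[ G , v ] _ y∈
           in uniq y (∈⇒∈N G y∈N) (∈-colorClass⁻ C y∈c)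

Colorable⇒CFCNColorable : ∀ (G : Graph n) → Colorable G m → CFCNColorable G (+ m)
Colorable⇒CFCNColorable G (f , cf) =
  (λ v → + suc (toℕ (f v))) ,
  (λ v → ℤ.+≤+ (s≤s z≤n) , ℤ.+≤+ (toℕ<n (f v))) ,
  ConflictFree⇒CFCN G
    (ConflictFree-refine G (λ _ _ → toℕ-injective ∘ ℕ.suc-injective ∘ ℤ.+-injective) cf)

CFCNColorable⇒Colorable : ∀ (G : Graph n) → CFCNColorable G (+ m) → Colorable G m
CFCNColorable⇒Colorable {n} {m} G (C , bounds , cf) = (proj₁ ∘ index) ,
  ConflictFree-refine G
    (λ y x fy≡fx → trans (proj₂ (index y)) (trans (cong (+_ ∘ suc ∘ toℕ) fy≡fx) (sym (proj₂ (index x)))))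
    (CFCN⇒ConflictFree G cf)
  where
  toFin : ∀ c → ℤ.1ℤ ℤ.≤ c → c ℤ.≤ + m → ∃ λ (i : Fin m) → c ≡ + suc (toℕ i)
  toFin (+ suc j) (ℤ.+≤+ _) (ℤ.+≤+ j<m) = fromℕ< j<m , cong (+_ ∘ suc) (sym (toℕ-fromℕ< j<m))
  toFin (+ zero) (ℤ.+≤+ ()) _
  index : ∀ v → ∃ λ (i : Fin m) → C v ≡ + suc (toℕ i)
  index v = toFin (C v) (proj₁ (bounds v)) (proj₂ (bounds v))

¬CFCNColorable-negative : ∀ (G : Graph n) {k} → 0 < n → ¬ CFCNColorable G -[1+ k ]
¬CFCNColorable-negative {suc n} G _ (C , bounds , _)
  with C zero | bounds zero
... | + _      | _ , ()
... | -[1+ _ ] | () , _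

Colorable-mono : ∀ (G : Graph n) {l} → m ≤ l → Colorable G m → Colorable G l
Colorable-mono G m≤l (f , cf) = (λ v → inject≤ (f v) m≤l) ,
  ConflictFree-refine G (λ _ _ → inject≤-injective m≤l m≤l _ _) cf

¬Colorable-0 : ∀ (G : Graph n) → 0 < n → ¬ Colorable G 0
¬Colorable-0 {suc n} G _ (f , _) with () ← f zero

Colorable-1-trivial : ∀ (G : Graph 1) → Colorable G 1
Colorable-1-trivial G = (λ _ → zero) , λ { zero → zero , inj₁ refl , λ { zero _ _ → refl } }

-- Two colors

Picked : Graph n → (w z v : Fin n) → Set
Picked G w z v = v ∈N[ G , w ] × ¬ v ≡ z

-- Spelled out as two implications so that it is literally the meaning of the formula `sameSideᶠ`.
SameSide : Graph n → (w z y x : Fin n) → Set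
SameSide G w z y x = (Picked G w z y → Picked G w z x) × (Picked G w z x → Picked G w z y)

picked? : ∀ (G : Graph n) w z v → Dec (Picked G w z v)
picked? G w z v = ∈N-dec G v w ×-dec ¬? (v Fin.≟ z)

SameSide⇒Colorable-2 : ∀ (G : Graph n) w z → ConflictFree G (SameSide G w z) → Colorable G 2
SameSide⇒Colorable-2 {n} G w z cf = side ∘ picked? G w z ,
  ConflictFree-refine G (λ y x → same (picked? G w z y) (picked? G w z x)) cf
  where
  side : ∀ {A : Set} → Dec A → Fin 2
  side (yes _) = suc zero
  side (no _)  = zero
  same : ∀ {A B : Set} (a : Dec A) (b : Dec B) → side a ≡ side b → (A → B) × (B → A)
  same (yes a) (yes b) _ = (λ _ → b) , (λ _ → a)
  same (no ¬a) (no ¬b) _ = (λ a → contradiction a ¬a) , (λ b → contradiction b ¬b)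

Universal : Graph n → Fin n → Set
Universal G u = ∀ v → u ∈N[ G , v ]

universal? : ∀ (G : Graph n) u → Dec (Universal G u)
universal? G u = all? (∈N-dec G u)

-- A universal vertex gets a color of its own.
Universal⇒SameSide : ∀ (G : Graph n) {u} → Universal G u → ConflictFree G (SameSide G u u)
Universal⇒SameSide G {u} univ v = u , univ v , λ y y∈ (y⇒u , _) →
  decidable-stable (y Fin.≟ u) λ y≢u →
    proj₂ (y⇒u (∈N-sym G (univ y) , y≢u)) refl

third-color : ∀ {a b : Fin 2} → a ≢ b → ∀ c → c ≡ a ⊎ c ≡ b
third-color {zero}     {zero}     a≢b c          = contradiction refl a≢b
third-color {suc zero} {suc zero} a≢b c          = contradiction refl a≢b
third-color {zero}     {suc zero} a≢b zero       = inj₁ refl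
third-color {zero}     {suc zero} a≢b (suc zero) = inj₂ refl
third-color {suc zero} {zero}     a≢b zero       = inj₂ refl
third-color {suc zero} {zero}     a≢b (suc zero) = inj₁ refl

∃-neighbor : ∀ (G : Graph n) → IsConnected G → ∀ {u v} → u ≢ v → ∃ λ w → Adj G u w
∃-neighbor G (_ , walk) {u} {v} u≢v with walk u v
... | ε = contradiction refl u≢v
... | uw ◅ _ = _ , uw

-- With a single color, both ends of an edge at vertex 0 would equal the uniquely colored vertex of
-- its neighborhood.
¬Colorable-1 : ∀ (G : Graph n) → IsConnected G → 1 < n → ¬ Colorable G 1
¬Colorable-1 {suc (suc n)} G conn _ (f , cf)
  with ∃-neighbor G conn {zero} {suc zero} (λ ()) | cf zero
... | u , 0u | x , x∈ , uniq =
  Adj⇒≢ G 0u (trans (uniq zero (inj₁ refl) (one _ _)) (sym (uniq u (inj₂ 0u) (one _ _))))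
  where
  one : ∀ (i j : Fin 1) → i ≡ j
  one zero zero = refl
¬Colorable-1 {suc zero} G _ (s≤s ())

-- Colorings of split graphs

module Split (G : Graph n) (K : Subset n)
             (clique : IsClique G K) (indep : IsIndependent G (∁ K)) where

  ∈K⇒∈N : ∀ {u v} → u ∈ K → v ∈ K → u ∈N[ G , v ]
  ∈K⇒∈N {u} {v} u∈K v∈K with u Fin.≟ v
  ... | yes u≡v = inj₁ u≡v
  ... | no u≢v  = inj₂ (clique v u v∈K u∈K (u≢v ∘ sym))

  neighbor∈K : ∀ {u v} → v ∉ K → Adj G v u → u ∈ K
  neighbor∈K {u} {v} v∉K vu = decidable-stable (u ∈? K) λ u∉K →
    indep v u (x∉p⇒x∈∁p v∉K) (x∉p⇒x∈∁p u∉K) vu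

  -- The vertex of K that will get a color of its own. If K is empty, vertex 0 is a harmless
  -- default, since `h ∈ K` is claimed only in the presence of a member of K.
  hub : 0 < n → ∃ λ h → ∀ {v} → v ∈ K → h ∈ K
  hub (s≤s _) with nonempty? K
  ... | yes (h , h∈K) = h , λ _ → h∈K
  ... | no ¬ne        = zero , λ v∈K → contradiction (_ , v∈K) ¬ne

  -- One color for a vertex of K, one for the rest of K, one for the
  -- independent set.
  colorable-3 : 0 < n → Colorable G 3
  colorable-3 0<n = f , cf
    where
    h = proj₁ (hub 0<n)

    color : ∀ {v} → Dec (v ∈ K) → Dec (v ≡ h) → Fin 3
    color (yes _) (yes _) = zero
    color (yes _) (no _)  = suc zero
    color (no _)  _       = suc (suc zero)

    f : Fin n → Fin 3
    f v = color (v ∈? K) (v Fin.≟ h)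

    f≡0 : ∀ y → y ∈ K → y ≡ h → f y ≡ zero
    f≡0 y y∈K y≡h with y ∈? K | y Fin.≟ h
    ... | yes _  | yes _  = refl
    ... | yes _  | no y≢h = contradiction y≡h y≢h
    ... | no y∉K | _      = contradiction y∈K y∉K

    f≡0⁻ : ∀ y → f y ≡ zero → y ≡ h
    f≡0⁻ y fy≡0 with y ∈? K | y Fin.≟ h
    ... | yes _ | yes y≡h = y≡h

    f≡2 : ∀ y → y ∉ K → f y ≡ suc (suc zero)
    f≡2 y y∉K with y ∈? K
    ... | yes y∈K = contradiction y∈K y∉K
    ... | no _    = refl

    f≡2⁻ : ∀ y → f y ≡ suc (suc zero) → y ∉ K
    f≡2⁻ y fy≡2 with y ∈? K | y Fin.≟ h
    ... | no y∉K | yes _ = y∉K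
    ... | no y∉K | no _  = y∉K

    cf : ConflictFree G (SameColor f)
    cf v with v ∈? K
    ... | yes v∈K = h , ∈K⇒∈N h∈K v∈K , λ y _ fy≡fh → f≡0⁻ y (trans fy≡fh (f≡0 h h∈K refl))
      where h∈K = proj₂ (hub 0<n) v∈K
    -- All neighbors of v lie in K, so v alone has the third color here.
    ... | no v∉K = v , inj₁ refl , λ where
      y (inj₁ y≡v) _     → y≡v
      y (inj₂ vy)  fy≡fv →
        contradiction (neighbor∈K v∉K vy) (f≡2⁻ y (trans fy≡fv (f≡2 v v∉K)))

  -- Two-colorings of split graphs without a universal vertex

  module Two (conn : IsConnected G)
             (f : Fin n → Fin 2) (cf : ConflictFree G (SameColor f))
             (¬univ : ∀ u → ¬ Universal G u) where

    non-neighbor : ∀ u → ∃ λ v → ¬ u ∈N[ G , v ]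
    non-neighbor u = ¬∀⟶∃¬ n _ (∈N-dec G u) (¬univ u)

    neighbor : ∀ u → ∃ λ v → Adj G u v
    neighbor u = let v , u∉Nv = non-neighbor u in ∃-neighbor G conn (u∉Nv ∘ inj₁)

    -- Both v and some neighbor of it would equal the uniquely colored vertex.
    ¬monochromatic : ∀ v → ¬ (∀ x → x ∈N[ G , v ] → f x ≡ f v)
    ¬monochromatic v mono =
      let u , vu = neighbor v
          x , x∈ , uniq = cf v
          v≡x = uniq v (inj₁ refl) (sym (mono x x∈))
          u≡x = uniq u (inj₂ vu) (trans (mono u (inj₂ vu)) (sym (mono x x∈)))
      in Adj⇒≢ G vu (trans v≡x (sym u≡x))

    neighbor-in-K : ∀ {v} → v ∉ K → ∃ λ u → u ∈ K × Adj G v u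
    neighbor-in-K {v} v∉K = let u , vu = neighbor v in u , neighbor∈K v∉K vu , vu

    K-nonempty : ∃ λ u → u ∈ K
    K-nonempty with nonempty? K
    ... | yes ne = ne
    ... | no ¬ne = let u , u∈K , _ = neighbor-in-K {v₀} (λ v∈K → ¬ne (_ , v∈K)) in u , u∈K
      where v₀ = fromℕ< (proj₁ conn)

    -- If K is monochromatic then the coloring is constant on K and on its
    -- complement, and a vertex w of K has exactly one neighbor z outside K.
    K-monochromatic : (∀ p q → p ∈ K → q ∈ K → f p ≡ f q) →
                      ∃₂ λ w z → ConflictFree G (SameSide G w z)
    K-monochromatic mono = w , z ,
      ConflictFree-refine G (λ y x → same y x (y ∈? K) (x ∈? K)) cf
      where
      w = proj₁ K-nonempty
      w∈K = proj₂ K-nonempty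

      -- All neighbors of v lie in K and share the color of w; if v had it too, its closed
      -- neighborhood would be monochromatic.
      outside : ∀ v → v ∉ K → f v ≢ f w
      outside v v∉K fv≡fw = ¬monochromatic v λ where
        x (inj₁ x≡v) → cong f x≡v
        x (inj₂ vx)  → trans (mono x w (neighbor∈K v∉K vx) w∈K) (sym fv≡fw)

      z = proj₁ (cf w)
      z∈Nw = proj₁ (proj₂ (cf w))
      z-unique = proj₂ (proj₂ (cf w))

      -- Otherwise uniqueness of z collapses K to {z}; every vertex outside K has a neighbor in K,
      -- which is then z, so z is universal.
      z∉K : z ∉ K
      z∉K z∈K = ¬univ z λ v → z∈N v (v ∈? K)
        where
        K≡z : ∀ u → u ∈ K → u ≡ z
        K≡z u u∈K = z-unique u (∈K⇒∈N u∈K w∈K) (mono u z u∈K z∈K)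
        z∈N : ∀ v → Dec (v ∈ K) → z ∈N[ G , v ]
        z∈N v (yes v∈K) = ∈K⇒∈N z∈K v∈K
        z∈N v (no v∉K) = let u , u∈K , vu = neighbor-in-K v∉K
                         in subst (_∈N[ G , v ]) (K≡z u u∈K) (inj₂ vu)

      ∈K⇒Picked : ∀ {v} → v ∈ K → Picked G w z v
      ∈K⇒Picked v∈K = ∈K⇒∈N v∈K w∈K , λ { refl → z∉K v∈K }

      same-outside : ∀ {u v} → u ∉ K → v ∉ K → f u ≡ f v
      same-outside {u} {v} u∉K v∉K with third-color (outside v v∉K) (f u)
      ... | inj₁ fu≡fv = fu≡fv
      ... | inj₂ fu≡fw = contradiction fu≡fw (outside u u∉K)

      -- Vertices outside K share the color of z, so z is the only one of them next to w. Together
      -- with `∈K⇒Picked` this identifies the picked set with K.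
      ∉K⇒¬Picked : ∀ {v} → v ∉ K → ¬ Picked G w z v
      ∉K⇒¬Picked {v} v∉K (v∈Nw , v≢z) = v≢z (z-unique v v∈Nw (same-outside v∉K z∉K))

      same : ∀ y x → Dec (y ∈ K) → Dec (x ∈ K) → SameSide G w z y x → f y ≡ f x
      same y x (yes y∈K) (yes x∈K) _       = mono y x y∈K x∈K
      same y x (yes y∈K) (no x∉K)  (y⇒x , _) = contradiction (y⇒x (∈K⇒Picked y∈K)) (∉K⇒¬Picked x∉K)
      same y x (no y∉K)  (yes x∈K) (_ , x⇒y) = contradiction (x⇒y (∈K⇒Picked x∈K)) (∉K⇒¬Picked y∉K)
      same y x (no y∉K)  (no x∉K)  _       = same-outside y∉K x∉K

    -- A color used twice in K is nowhere unique on the neighborhoods of K,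
    -- so p is the only vertex of its color there, which makes p universal.
    no-three : ∀ {p q r} → p ∈ K → q ∈ K → r ∈ K → f p ≢ f q → f r ≡ f q → ¬ r ≢ q
    no-three {p} {q} {r} p∈K q∈K r∈K fp≢fq fr≡fq r≢q = ¬univ p λ v → p∈N v (v ∈? K)
      where
      only-p : ∀ {u} → u ∈ K → ∀ {y} → y ∈N[ G , u ] → f y ≡ f p → y ≡ p
      only-p {u} u∈K {y} y∈ fy≡fp with cf u
      ... | x , x∈ , uniq with third-color fp≢fq (f x)
      ... | inj₁ fx≡fp = trans (uniq y y∈ (trans fy≡fp (sym fx≡fp)))
                               (sym (uniq p (∈K⇒∈N p∈K u∈K) (sym fx≡fp)))
      ... | inj₂ fx≡fq = contradiction
        (trans (uniq r (∈K⇒∈N r∈K u∈K) (trans fr≡fq (sym fx≡fq)))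
               (sym (uniq q (∈K⇒∈N q∈K u∈K) (sym fx≡fq)))) r≢q

      p∈N : ∀ v → Dec (v ∈ K) → p ∈N[ G , v ]
      p∈N v (yes v∈K) = ∈K⇒∈N p∈K v∈K
      -- If p is not in this neighborhood, none of its vertices has the color of p: such a vertex
      -- lies in the neighborhood of a vertex of K, so it is p by `only-p`. The neighborhood would
      -- be monochromatic.
      p∈N v (no v∉K) = decidable-stable (∈N-dec G p v) λ p∉Nv →
        let u , u∈K , vu = neighbor-in-K v∉K
            f-q : ∀ x → x ∈N[ G , v ] → f x ≡ f q
            f-q x x∈ = [ (λ fx≡fp → contradiction (subst (_∈N[ G , v ])
                            (x≡p x x∈ fx≡fp u∈K vu) x∈) p∉Nv) , id ]′
                       (third-color fp≢fq (f x))
        in ¬monochromatic v λ x x∈ → trans (f-q x x∈) (sym (f-q v (inj₁ refl)))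
        where
        x≡p : ∀ x → x ∈N[ G , v ] → f x ≡ f p → ∀ {u} → u ∈ K → Adj G v u → x ≡ p
        x≡p x (inj₁ refl) fx≡fp u∈K vu = only-p u∈K (inj₂ (Adj-sym G vu)) fx≡fp
        x≡p x (inj₂ vx)   fx≡fp u∈K vu = only-p (neighbor∈K v∉K vx) (inj₁ refl) fx≡fp

    module _ {p q} (p∈K : p ∈ K) (q∈K : q ∈ K) (fp≢fq : f p ≢ f q)
             (K≡pq : ∀ {r} → r ∈ K → r ≡ p ⊎ r ≡ q) where

      -- Such a v lies outside K, so q is its only possible neighbor; with the color of q its closed
      -- neighborhood would be monochromatic.
      non-neighbor-color : ∀ {v} → ¬ v ∈N[ G , p ] → f v ≡ f p
      non-neighbor-color {v} v∉Np with third-color fp≢fq (f v)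
      ... | inj₁ fv≡fp = fv≡fp
      ... | inj₂ fv≡fq = contradiction mono (¬monochromatic v)
        where
        mono : ∀ x → x ∈N[ G , v ] → f x ≡ f v
        mono x (inj₁ x≡v) = cong f x≡v
        mono x (inj₂ vx) with K≡pq (neighbor∈K (λ v∈K → v∉Np (∈K⇒∈N v∈K p∈K)) vx)
        ... | inj₁ refl = contradiction (inj₂ (Adj-sym G vx)) v∉Np
        ... | inj₂ refl = sym fv≡fq

      -- The uniquely colored vertex of the neighborhood of p cannot have the color of q: that color
      -- occurs there at q and at any y not adjacent to q, since such a y hangs on p and has the
      -- color of q by `non-q`. The premise is `non-neighbor-color` with p and q exchanged.
      neighbor-color : (∀ {v} → ¬ v ∈N[ G , q ] → f v ≡ f q) →
                       ∀ {v} → v ∈N[ G , p ] → f v ≡ f p → v ≡ p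
      neighbor-color non-q {v} v∈Np fv≡fp with cf p
      ... | x , x∈ , uniq with third-color fp≢fq (f x)
      ... | inj₁ fx≡fp = trans (uniq v v∈Np (trans fv≡fp (sym fx≡fp)))
                               (sym (uniq p (inj₁ refl) (sym fx≡fp)))
      ... | inj₂ fx≡fq = contradiction (subst (_∈N[ G , q ]) q≡y (inj₁ refl)) y∉Nq
        where
        y = proj₁ (non-neighbor q)
        y∉Nq : ¬ y ∈N[ G , q ]
        y∉Nq = proj₂ (non-neighbor q) ∘ ∈N-sym G
        y∈Np : y ∈N[ G , p ]
        y∈Np with neighbor-in-K (λ y∈K → y∉Nq (∈K⇒∈N y∈K q∈K))
        ... | u , u∈K , yu with K≡pq u∈K
        ... | inj₁ refl = inj₂ (Adj-sym G yu)
        ... | inj₂ refl = contradiction (inj₂ (Adj-sym G yu)) y∉Nq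
        q≡y : q ≡ y
        q≡y = trans (uniq q (∈K⇒∈N q∈K p∈K) (sym fx≡fq))
                    (sym (uniq y y∈Np (trans (non-q y∉Nq) (sym fx≡fq))))

    -- If K = {p , q} with p and q of different colors then G is a double star.
    K-pair : ∀ {p q} → p ∈ K → q ∈ K → f p ≢ f q → (∀ {r} → r ∈ K → r ≡ p ⊎ r ≡ q) →
             ConflictFree G (SameSide G p p)
    K-pair {p} {q} p∈K q∈K fp≢fq K≡pq =
      ConflictFree-refine G (λ y x → same y x (picked? G p p y) (picked? G p p x)) cf
      where
      non-q : ∀ {v} → ¬ v ∈N[ G , q ] → f v ≡ f q
      non-q = non-neighbor-color q∈K p∈K (fp≢fq ∘ sym) ([ inj₂ , inj₁ ]′ ∘ K≡pq)

      -- For `w = z = p` the picked set is the open neighborhood of p; with `¬Picked⇒f` it is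
      -- exactly the color class of q.
      Picked⇒f : ∀ {v} → Picked G p p v → f v ≡ f q
      Picked⇒f {v} (v∈Np , v≢p) with third-color fp≢fq (f v)
      ... | inj₁ fv≡fp = contradiction (neighbor-color p∈K q∈K fp≢fq K≡pq non-q v∈Np fv≡fp) v≢p
      ... | inj₂ fv≡fq = fv≡fq

      ¬Picked⇒f : ∀ {v} → ¬ Picked G p p v → f v ≡ f p
      ¬Picked⇒f {v} ¬picked with v Fin.≟ p
      ... | yes v≡p = cong f v≡p
      ... | no v≢p  = non-neighbor-color p∈K q∈K fp≢fq K≡pq (λ v∈Np → ¬picked (v∈Np , v≢p))

      same : ∀ y x → Dec (Picked G p p y) → Dec (Picked G p p x) → SameSide G p p y x → f y ≡ f x
      same y x (yes py) (yes px) _       = trans (Picked⇒f py) (sym (Picked⇒f px))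
      same y x (yes py) (no ¬px) (y⇒x , _) = contradiction (y⇒x py) ¬px
      same y x (no ¬py) (yes px) (_ , x⇒y) = contradiction (x⇒y px) ¬py
      same y x (no ¬py) (no ¬px) _       = trans (¬Picked⇒f ¬py) (sym (¬Picked⇒f ¬px))

    -- r has the color of p or of q, and `no-three` excludes a second vertex of K of either color.
    K-pair-members : ∀ {p q} → p ∈ K → q ∈ K → f p ≢ f q → ∀ {r} → r ∈ K → r ≡ p ⊎ r ≡ q
    K-pair-members {p} {q} p∈K q∈K fp≢fq {r} r∈K with third-color fp≢fq (f r)
    ... | inj₁ fr≡fp = inj₁ (decidable-stable (r Fin.≟ p) (no-three q∈K p∈K r∈K (fp≢fq ∘ sym) fr≡fp))
    ... | inj₂ fr≡fq = inj₂ (decidable-stable (r Fin.≟ q) (no-three p∈K q∈K r∈K fp≢fq fr≡fq))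

    sameSide : ∃₂ λ w z → ConflictFree G (SameSide G w z)
    sameSide with any? (λ p → any? (λ q → (p ∈? K) ×-dec (q ∈? K) ×-dec ¬? (f p Fin.≟ f q)))
    ... | yes (p , q , p∈K , q∈K , fp≢fq) =
      p , p , K-pair p∈K q∈K fp≢fq (K-pair-members p∈K q∈K fp≢fq)
    ... | no ¬pq = K-monochromatic λ p q p∈K q∈K →
      decidable-stable (f p Fin.≟ f q) λ fp≢fq → ¬pq (p , q , p∈K , q∈K , fp≢fq)

  Colorable-2⇒SameSide : IsConnected G → Colorable G 2 → ∃₂ λ w z → ConflictFree G (SameSide G w z)
  Colorable-2⇒SameSide conn (f , cf) with any? (universal? G)
  ... | yes (u , univ) = u , u , Universal⇒SameSide G univ
  ... | no ¬univ       = Two.sameSide conn f cf λ u univ → ¬univ (u , univ)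

Reflects-map : ∀ {A B : Set} {a} → (A → B) → (B → A) → Reflects A a → Reflects B a
Reflects-map f g (ofʸ a)  = ofʸ (f a)
Reflects-map f g (ofⁿ ¬a) = ofⁿ (¬a ∘ g)

-- First-order logic of graphs

data Connective : Set where
  and or imp : Connective

data Quantifier : Set where
  all some : Quantifier

data Formula (m : ℕ) : Set where
  _≐_ _~_ : Fin m → Fin m → Formula m
  neg     : Formula m → Formula m
  bin     : Connective → Formula m → Formula m → Formula m
  quant   : Quantifier → Formula (suc m) → Formula m

Connect : Connective → Set → Set → Set
Connect and A B = A × B
Connect or  A B = A ⊎ B
Connect imp A B = A → B

Quantify : ∀ {A : Set} → Quantifier → (A → Set) → Set
Quantify all  P = ∀ x → P x
Quantify some P = ∃ P

Sat : Graph n → Formula m → Vec (Fin n) m → Set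
Sat G (i ≐ j)     ρ = lookup ρ i ≡ lookup ρ j
Sat G (i ~ j)     ρ = Adj G (lookup ρ i) (lookup ρ j)
Sat G (neg φ)     ρ = ¬ Sat G φ ρ
Sat G (bin o φ ψ) ρ = Connect o (Sat G φ ρ) (Sat G ψ ρ)
Sat G (quant q φ) ρ = Quantify q λ x → Sat G φ (x ∷ ρ)

connect : Connective → Bool → Bool → Bool
connect and a b = a ∧ b
connect or  a b = a ∨ b
connect imp a b = not a ∨ b

connect-reflects : ∀ o {A B : Set} {a b} → Reflects A a → Reflects B b →
                   Reflects (Connect o A B) (connect o a b)
connect-reflects and = _×-reflects_
connect-reflects or  = _⊎-reflects_
connect-reflects imp = _→-reflects_

connective : Quantifier → Connective
connective all  = and
connective some = or

unit : Quantifier → Bool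
unit all  = true
unit some = false

-- The part of a quantifier that its loop has evaluated after i rounds.
Below : Quantifier → (Fin n → Set) → ℕ → Set
Below all  P i = ∀ x → toℕ x < i → P x
Below some P i = ∃ λ x → toℕ x < i × P x

Below-zero : ∀ q {P : Fin n → Set} → Reflects (Below q P 0) (unit q)
Below-zero all  = ofʸ λ _ ()
Below-zero some = ofⁿ λ ()

Below-suc : ∀ q {P : Fin n → Set} x {a b} →
            Reflects (Below q P (toℕ x)) a → Reflects (P x) b →
            Reflects (Below q P (suc (toℕ x))) (connect (connective q) a b)
Below-suc {n} q {P} x ra rb =
  Reflects-map (to q) (from q) (connect-reflects (connective q) ra rb)
  where
  split : ∀ {y : Fin n} → toℕ y < suc (toℕ x) → toℕ y < toℕ x ⊎ y ≡ x
  split (s≤s y≤x) = [ inj₁ , inj₂ ∘ toℕ-injective ]′ (ℕ.m≤n⇒m<n∨m≡n y≤x)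
  to : ∀ q → Connect (connective q) (Below q P (toℕ x)) (P x) → Below q P (suc (toℕ x))
  to all (below , px) y y<1+x =
    [ below y , (λ y≡x → subst P (sym y≡x) px) ]′ (split y<1+x)
  to some (inj₁ (y , y<x , py)) = y , ℕ.m<n⇒m<1+n y<x , py
  to some (inj₂ px)             = x , ℕ.n<1+n _ , px
  from : ∀ q → Below q P (suc (toℕ x)) → Connect (connective q) (Below q P (toℕ x)) (P x)
  from all below = (λ y → below y ∘ ℕ.m<n⇒m<1+n) , below x (ℕ.n<1+n _)
  from some (y , y<1+x , py) =
    [ (λ y<x → inj₁ (y , y<x , py)) , (λ y≡x → inj₂ (subst P y≡x py)) ]′ (split y<1+x)

Below-all : ∀ q {P : Fin n → Set} {a} → Reflects (Below q P n) a → Reflects (Quantify q P) a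
Below-all all  = Reflects-map (λ below x → below x (toℕ<n x)) (λ ∀P x _ → ∀P x)
Below-all some = Reflects-map (λ (x , _ , px) → x , px) (λ (x , px) → x , toℕ<n x , px)

-- Compilation to RAM programs

-- On bits, subtraction from 1 is negation. Thus `or` caps the sum at 1 by a double negation, `and`
-- is the excess of the sum over 1, and `imp` negates "e without f".
connectᵉ : Connective → Expr → Expr → Expr
connectᵉ and e f = e ⊕ f ⊖ num 1
connectᵉ or  e f = num 1 ⊖ (num 1 ⊖ (e ⊕ f))
connectᵉ imp e f = num 1 ⊖ (e ⊖ f)

-- Register 0 holds n.  A variable x is kept in two adjacent registers as x
-- and n * x, so that matrix entries are addressed without multiplication; σ
-- lists the first of these registers for each variable.  The program only
-- writes to the registers from b on and leaves the truth value in b.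
compile : Formula m → Vec ℕ m → ℕ → Cmd
compile (i ≐ j) σ b =
  b ≔ num 1 ⊖ ((reg (lookup σ i) ⊖ reg (lookup σ j)) ⊕ (reg (lookup σ j) ⊖ reg (lookup σ i)))
compile (i ~ j) σ b =
  b ≔ mem (reg (suc (lookup σ i)) ⊕ reg (lookup σ j))
compile (neg φ) σ b =
  compile φ σ b ⨾
  b ≔ num 1 ⊖ reg b
compile (bin o φ ψ) σ b =
  compile φ σ b ⨾
  compile ψ σ (1 + b) ⨾
  b ≔ connectᵉ o (reg b) (reg (1 + b))
compile (quant q φ) σ b =
  -- Register b accumulates the truth value, 1 + b and 2 + b hold the bound vertex x and n * x, and
  -- the body works from 3 + b on.
  b ≔ num (bit (unit q)) ⨾
  1 + b ≔ num 0 ⨾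
  2 + b ≔ num 0 ⨾
  while≢0 reg 0 ⊖ reg (1 + b) loop
    (compile φ (1 + b ∷ σ) (3 + b) ⨾
     b ≔ connectᵉ (connective q) (reg b) (reg (3 + b)) ⨾
     1 + b ≔ reg (1 + b) ⊕ num 1 ⨾
     2 + b ≔ reg (2 + b) ⊕ reg 0)

-- In a loop, each guard costs 4 and the three updates of a round at most 16; the final 4 is the
-- guard that fails.
time : Formula m → ℕ → ℕ
time (i ≐ j)     n = 10
time (i ~ j)     n = 5
time (neg φ)     n = time φ n + 4
time (bin o φ ψ) n = time φ n + (time ψ n + 8)
time (quant q φ) n = 2 + (2 + (2 + (n * (4 + (time φ n + 16)) + 4)))

-- Correctness and cost of the compiled programs

connectᵉ-value : ∀ o {e f s a b} → ⟦ e ⟧ s ≡ bit a → ⟦ f ⟧ s ≡ bit b →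
                 ⟦ connectᵉ o e f ⟧ s ≡ bit (connect o a b)
connectᵉ-value and {a = a} {b} p q rewrite p | q with a | b
... | true  | true  = refl
... | true  | false = refl
... | false | true  = refl
... | false | false = refl
connectᵉ-value or {a = a} {b} p q rewrite p | q with a | b
... | true  | true  = refl
... | true  | false = refl
... | false | true  = refl
... | false | false = refl
connectᵉ-value imp {a = a} {b} p q rewrite p | q with a | b
... | true  | true  = refl
... | true  | false = refl
... | false | true  = refl
... | false | false = refl

connectᵉ-cost : ∀ o {i j} → suc (cost (connectᵉ o (reg i) (reg j))) ≤ 8
connectᵉ-cost and = ℕ.m≤m+n 6 2
connectᵉ-cost or  = ℕ.≤-refl
connectᵉ-cost imp = ℕ.m≤m+n 6 2

-- One of the two truncated differences is zero, so their sum is the distance, which vanishes only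
-- for equal vertices.
≐-value : ∀ (x y : Fin n) →
          1 ∸ ((toℕ x ∸ toℕ y) + (toℕ y ∸ toℕ x)) ≡ bit (does (x Fin.≟ y))
≐-value x y with x Fin.≟ y
... | yes refl rewrite ℕ.n∸n≡0 (toℕ x) = refl
... | no x≢y with ℕ.<-cmp (toℕ x) (toℕ y)
... | tri< x<y _ _ rewrite ℕ.m≤n⇒m∸n≡0 (ℕ.<⇒≤ x<y) = ℕ.m≤n⇒m∸n≡0 (ℕ.m<n⇒0<n∸m x<y)
... | tri≈ _ x≡y _ = contradiction (toℕ-injective x≡y) x≢y
... | tri> _ _ y<x = ℕ.m≤n⇒m∸n≡0 (ℕ.≤-trans (ℕ.m<n⇒0<n∸m y<x) (ℕ.m≤m+n _ _))

↦-same : ∀ f i {x} → (f [ i ↦ x ]) i ≡ x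
↦-same f i {x} = cong (if_then x else f i) (dec-true (i ℕ.≟ i) refl)

↦-other : ∀ f i {x j} → j ≢ i → (f [ i ↦ x ]) j ≡ f j
↦-other f i {x} {j} j≢i = cong (if_then x else f j) (dec-false (j ℕ.≟ i) j≢i)

-- The address is the index of `combine u v`; this puts it in range and lets `remQuot` recover u and
-- v.
adjacencyMatrix-entry : ∀ (G : Graph n) u v →
                        adjacencyMatrix G (n * toℕ u + toℕ v) ≡ bit (adj G u v)
adjacencyMatrix-entry {n} G u v
  with n * toℕ u + toℕ v ℕ.<? n * n
... | yes i<n*n = cong (bit ∘ uncurry (adj G)) (begin
    remQuot n (fromℕ< i<n*n)
      ≡⟨ cong (remQuot n) (toℕ-injective (trans (toℕ-fromℕ< i<n*n) (sym (toℕ-combine u v)))) ⟩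
    remQuot n (combine u v)
      ≡⟨ remQuot-combine u v ⟩
    u , v ∎)
  where open ≡-Reasoning
... | no i≮n*n = contradiction
  (subst (_< n * n) (toℕ-combine u v) (toℕ<n (combine u v))) i≮n*n

-- Total correctness from a given start state, with time bound T.
Runs : Cmd → State → ℕ → (State → Set) → Set
Runs c s T Q = ∃₂ λ t s′ → ⟨ c , s ⟩⇓[ t ] s′ × t ≤ T × Q s′

Frame : ℕ → State → State → Set
Frame b s s′ = memory s′ ≡ memory s × (∀ {r} → r < b → regs s′ r ≡ regs s r)

Frame-trans : ∀ {b s₁ s₂ s₃} → Frame b s₁ s₂ → Frame b s₂ s₃ → Frame b s₁ s₃
Frame-trans (m₁ , r₁) (m₂ , r₂) = trans m₂ m₁ , λ r<b → trans (r₂ r<b) (r₁ r<b)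

Frame-weaken : ∀ {b b′ s s′} → b ≤ b′ → Frame b′ s s′ → Frame b s s′
Frame-weaken b≤b′ (m , r) = m , λ r<b → r (ℕ.<-≤-trans r<b b≤b′)

assigned : State → ℕ → ℕ → State
assigned s i x = ⟪ regs s [ i ↦ x ] , memory s ⟫

Frame-assign : ∀ {b s i x} → b ≤ i → Frame b s (assigned s i x)
Frame-assign {s = s} {i} b≤i = refl , λ r<b → ↦-other (regs s) i (ℕ.<⇒≢ (ℕ.<-≤-trans r<b b≤i))

Answer : Set → ℕ → Set
Answer A x = ∃ λ a → x ≡ bit a × Reflects A a

module _ (G : Graph n) where

  -- The precondition of a compiled formula: all registers it takes as input lie below its work
  -- registers, so `Frame b` preserves it.
  record Env (σ : Vec ℕ m) (ρ : Vec (Fin n) m) (b : ℕ) (s : State) : Set where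
    field
      matrix : memory s ≡ adjacencyMatrix G
      0<b    : 0 < b
      order  : regs s 0 ≡ n
      below  : ∀ i → suc (lookup σ i) < b
      var    : ∀ i → regs s (lookup σ i) ≡ toℕ (lookup ρ i)
      n*var  : ∀ i → regs s (suc (lookup σ i)) ≡ n * toℕ (lookup ρ i)

  open Env

  Env-frame : ∀ {σ : Vec ℕ m} {ρ b s s′} → Env σ ρ b s → Frame b s s′ → Env σ ρ b s′
  Env-frame env (mem≡ , regs≡) = record
    { matrix = trans mem≡ (matrix env)
    ; 0<b    = 0<b env
    ; order  = trans (regs≡ (0<b env)) (order env)
    ; below  = below env
    ; var    = λ i → trans (regs≡ (ℕ.<-trans (ℕ.n<1+n _) (below env i))) (var env i)
    ; n*var  = λ i → trans (regs≡ (below env i)) (n*var env i)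
    }

  Env-raise : ∀ {σ : Vec ℕ m} {ρ b b′ s} → b ≤ b′ → Env σ ρ b s → Env σ ρ b′ s
  Env-raise b≤b′ env = record
    { matrix = matrix env
    ; 0<b    = ℕ.<-≤-trans (0<b env) b≤b′
    ; order  = order env
    ; below  = λ i → ℕ.<-≤-trans (below env i) b≤b′
    ; var    = var env
    ; n*var  = n*var env
    }

  Env-extend : ∀ {σ : Vec ℕ m} {ρ b s} x → Env σ ρ b s →
               regs s (1 + b) ≡ toℕ x → regs s (2 + b) ≡ n * toℕ x →
               Env (1 + b ∷ σ) (x ∷ ρ) (3 + b) s
  Env-extend {b = b} x env reg-x reg-n*x = record
    { matrix = matrix env
    ; 0<b    = s≤s z≤n
    ; order  = order env
    ; below  = λ { zero → ℕ.n<1+n _ ; (suc i) → ℕ.<-≤-trans (below env i) (ℕ.m≤n+m b 3) }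
    ; var    = λ { zero → reg-x ; (suc i) → var env i }
    ; n*var  = λ { zero → reg-n*x ; (suc i) → n*var env i }
    }

  -- The invariant of the quantifier loop after i rounds.
  record Round (σ : Vec ℕ m) (ρ : Vec (Fin n) m) (b : ℕ) (q : Quantifier) (P : Fin n → Set)
               (i : ℕ) (s : State) : Set where
    field
      env     : Env σ ρ b s
      acc     : Answer (Below q P i) (regs s b)
      index   : regs s (1 + b) ≡ i
      n*index : regs s (2 + b) ≡ n * i

  -- Induction on the formula, mutual with `round` for one pass through a quantifier loop and
  -- `iterate` for the passes that remain.
  compile-correct : ∀ (φ : Formula m) σ ρ b s → Env σ ρ b s →
    Runs (compile φ σ b) s (time φ n) λ s′ → Frame b s s′ × Answer (Sat G φ ρ) (regs s′ b)

  round : ∀ q (φ : Formula (suc m)) σ ρ b x s →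
    Round σ ρ b q (λ x → Sat G φ (x ∷ ρ)) (toℕ x) s →
    Runs (compile φ (1 + b ∷ σ) (3 + b) ⨾
          b ≔ connectᵉ (connective q) (reg b) (reg (3 + b)) ⨾
          1 + b ≔ reg (1 + b) ⊕ num 1 ⨾
          2 + b ≔ reg (2 + b) ⊕ reg 0)
         s (time φ n + 16) λ s′ →
      Frame b s s′ × Round σ ρ b q (λ x → Sat G φ (x ∷ ρ)) (suc (toℕ x)) s′

  -- Induction on the number k of remaining rounds; once i reaches n, the bounded quantifier of the
  -- invariant is the full one.
  iterate : ∀ q (φ : Formula (suc m)) σ ρ b k i s → i + k ≡ n →
    Round σ ρ b q (λ x → Sat G φ (x ∷ ρ)) i s →
    Runs (while≢0 reg 0 ⊖ reg (1 + b) loop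
           (compile φ (1 + b ∷ σ) (3 + b) ⨾
            b ≔ connectᵉ (connective q) (reg b) (reg (3 + b)) ⨾
            1 + b ≔ reg (1 + b) ⊕ num 1 ⨾
            2 + b ≔ reg (2 + b) ⊕ reg 0))
         s (k * (4 + (time φ n + 16)) + 4) λ s′ →
      Frame b s s′ × Answer (Sat G (quant q φ) ρ) (regs s′ b)

  compile-correct (i ≐ j) σ ρ b s env =
    _ , _ , assign , ℕ.≤-refl , Frame-assign {s = s} ℕ.≤-refl ,
    does (x Fin.≟ y) , trans (↦-same (regs s) b) value , proof (x Fin.≟ y)
    where
    x = lookup ρ i
    y = lookup ρ j
    value : 1 ∸ ((regs s (lookup σ i) ∸ regs s (lookup σ j)) +
                 (regs s (lookup σ j) ∸ regs s (lookup σ i))) ≡ bit (does (x Fin.≟ y))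
    value rewrite var env i | var env j = ≐-value x y
  compile-correct (i ~ j) σ ρ b s env =
    _ , _ , assign , ℕ.≤-refl , Frame-assign {s = s} ℕ.≤-refl ,
    adj G x y , trans (↦-same (regs s) b) value , reflects
    where
    x = lookup ρ i
    y = lookup ρ j
    value : memory s (regs s (suc (lookup σ i)) + regs s (lookup σ j)) ≡ bit (adj G x y)
    value rewrite n*var env i | var env j | matrix env = adjacencyMatrix-entry G x y
    reflects : Reflects (adj G x y ≡ true) (adj G x y)
    reflects with adj G x y
    ... | true  = ofʸ refl
    ... | false = ofⁿ λ ()
  compile-correct (neg φ) σ ρ b s env
    with compile-correct φ σ ρ b s env
  ... | t , s₁ , run , t≤ , frame , a , reg≡ , reflects =
    _ , _ , seq run assign , ℕ.+-monoˡ-≤ 4 t≤ ,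
    Frame-trans frame (Frame-assign {s = s₁} ℕ.≤-refl) ,
    not a , trans (↦-same (regs s₁) b) (trans (cong (1 ∸_) reg≡) (value a)) , ¬-reflects reflects
    where
    value : ∀ a → 1 ∸ bit a ≡ bit (not a)
    value true  = refl
    value false = refl
  compile-correct (bin o φ ψ) σ ρ b s env
    with compile-correct φ σ ρ b s env
  ... | t₁ , s₁ , run₁ , t₁≤ , frame₁ , a₁ , reg≡₁ , reflects₁
    -- Starting its work registers at `suc b`, the second program keeps the first truth value in b.
    with compile-correct ψ σ ρ (suc b) s₁ (Env-raise (ℕ.n≤1+n b) (Env-frame env frame₁))
  ... | t₂ , s₂ , run₂ , t₂≤ , frame₂ , a₂ , reg≡₂ , reflects₂ =
    _ , _ , seq run₁ (seq run₂ assign) ,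
    ℕ.+-mono-≤ t₁≤ (ℕ.+-mono-≤ t₂≤ (connectᵉ-cost o)) ,
    Frame-trans frame₁ (Frame-trans (Frame-weaken (ℕ.n≤1+n b) frame₂) (Frame-assign {s = s₂} ℕ.≤-refl)) ,
    connect o a₁ a₂ ,
    trans (↦-same (regs s₂) b)
          (connectᵉ-value o {reg b} {reg (1 + b)} {s₂} (trans (proj₂ frame₂ (ℕ.n<1+n b)) reg≡₁) reg≡₂) ,
    connect-reflects o reflects₁ reflects₂
  compile-correct (quant q φ) σ ρ b s env =
    let t , s₄ , run , t≤ , frame , answer = iterate q φ σ ρ b n 0 s₃ refl start
    in _ , s₄ , seq assign (seq assign (seq assign run)) ,
       ℕ.+-monoʳ-≤ 6 t≤ , Frame-trans frame₃ frame , answer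
    where
    s₁ = assigned s b (bit (unit q))
    s₂ = assigned s₁ (1 + b) 0
    s₃ = assigned s₂ (2 + b) 0
    frame₁₃ : Frame (1 + b) s₁ s₃
    frame₁₃ = Frame-trans (Frame-assign {s = s₁} ℕ.≤-refl) (Frame-assign {s = s₂} (ℕ.n≤1+n _))
    frame₃ : Frame b s s₃
    frame₃ = Frame-trans (Frame-assign {s = s} ℕ.≤-refl) (Frame-weaken (ℕ.n≤1+n b) frame₁₃)
    start : Round σ ρ b q (λ x → Sat G φ (x ∷ ρ)) 0 s₃
    start = record
      { env     = Env-frame env frame₃
      ; acc     = unit q , trans (proj₂ frame₁₃ (ℕ.n<1+n b)) (↦-same (regs s) b) , Below-zero q
      ; index   = trans (↦-other (regs s₂) (2 + b) (ℕ.<⇒≢ (ℕ.n<1+n _))) (↦-same (regs s₁) (1 + b))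
      ; n*index = trans (↦-same (regs s₂) (2 + b)) (sym (ℕ.*-zeroʳ n))
      }

  round q φ σ ρ b x s start
    with compile-correct φ (1 + b ∷ σ) (x ∷ ρ) (3 + b) s
           (Env-extend x (Round.env start) (Round.index start) (Round.n*index start))
       | Round.acc start
  ... | t , s₁ , run , t≤ , frame₁ , a , reg≡a , a-reflects | c , reg≡c , c-reflects =
    _ , s₄ , seq run (seq assign (seq assign assign)) ,
    ℕ.+-mono-≤ t≤ (ℕ.+-monoˡ-≤ 8 (connectᵉ-cost (connective q))) ,
    frame ,
    record
      { env     = Env-frame (Round.env start) frame
      ; acc     = connect (connective q) c a ,
                  trans (proj₂ frame₂₄ (ℕ.n<1+n b))
                    (trans (↦-same (regs s₁) b)
                      (connectᵉ-value (connective q) {reg b} {reg (3 + b)} {s₁}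
                        (trans (proj₂ frame₁ (ℕ.m≤n+m (suc b) 2)) reg≡c) reg≡a)) ,
                  Below-suc q x c-reflects a-reflects
      ; index   = begin
          regs s₄ (1 + b)     ≡⟨ ↦-other (regs s₃) (2 + b) (ℕ.<⇒≢ (ℕ.n<1+n _)) ⟩
          regs s₃ (1 + b)     ≡⟨ ↦-same (regs s₂) (1 + b) ⟩
          regs s₂ (1 + b) + 1 ≡⟨ cong (_+ 1) (↦-other (regs s₁) b (ℕ.>⇒≢ (ℕ.n<1+n b))) ⟩
          regs s₁ (1 + b) + 1 ≡⟨ cong (_+ 1) (proj₂ frame₁ (ℕ.n≤1+n _)) ⟩
          regs s (1 + b) + 1  ≡⟨ cong (_+ 1) (Round.index start) ⟩
          toℕ x + 1           ≡⟨ ℕ.+-comm (toℕ x) 1 ⟩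
          suc (toℕ x)         ∎
      ; n*index = begin
          regs s₄ (2 + b)             ≡⟨ ↦-same (regs s₃) (2 + b) ⟩
          regs s₃ (2 + b) + regs s₃ 0 ≡⟨ cong₂ _+_ reg-2+b (order (Env-frame (Round.env start) frame₃)) ⟩
          n * toℕ x + n               ≡⟨ ℕ.+-comm _ n ⟩
          n + n * toℕ x               ≡⟨ ℕ.*-suc n (toℕ x) ⟨
          n * suc (toℕ x)             ∎
      }
    where
    open ≡-Reasoning
    s₂ = assigned s₁ b (⟦ connectᵉ (connective q) (reg b) (reg (3 + b)) ⟧ s₁)
    s₃ = assigned s₂ (1 + b) (regs s₂ (1 + b) + 1)
    s₄ = assigned s₃ (2 + b) (regs s₃ (2 + b) + regs s₃ 0)
    frame₂₄ : Frame (1 + b) s₂ s₄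
    frame₂₄ = Frame-trans (Frame-assign {s = s₂} ℕ.≤-refl) (Frame-assign {s = s₃} (ℕ.n≤1+n _))
    frame₂ : Frame b s s₂
    frame₂ = Frame-trans (Frame-weaken (ℕ.m≤n+m b 3) frame₁) (Frame-assign {s = s₁} ℕ.≤-refl)
    frame₃ : Frame b s s₃
    frame₃ = Frame-trans frame₂ (Frame-assign {s = s₂} (ℕ.n≤1+n b))
    frame : Frame b s s₄
    frame = Frame-trans frame₂ (Frame-weaken (ℕ.n≤1+n b) frame₂₄)
    reg-2+b : regs s₃ (2 + b) ≡ n * toℕ x
    reg-2+b = begin
      regs s₃ (2 + b) ≡⟨ ↦-other (regs s₂) (1 + b) (ℕ.>⇒≢ (ℕ.n<1+n _)) ⟩
      regs s₂ (2 + b) ≡⟨ ↦-other (regs s₁) b (ℕ.>⇒≢ (ℕ.m≤n+m (suc b) 1)) ⟩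
      regs s₁ (2 + b) ≡⟨ proj₂ frame₁ ℕ.≤-refl ⟩
      regs s (2 + b)  ≡⟨ Round.n*index start ⟩
      n * toℕ x       ∎

  iterate q φ σ ρ b zero i s i+0≡n inv =
    _ , s , while-end guard , ℕ.≤-refl , (refl , λ _ → refl) ,
    let c , reg≡c , c-reflects = Round.acc inv
    in c , reg≡c , Below-all q (subst (λ i → Reflects (Below q _ i) c) i≡n c-reflects)
    where
    i≡n = trans (sym (ℕ.+-identityʳ i)) i+0≡n
    guard : regs s 0 ∸ regs s (1 + b) ≡ 0
    guard rewrite order (Round.env inv) | Round.index inv | i≡n = ℕ.n∸n≡0 n
  iterate q φ σ ρ b (suc k) i s i+1+k≡n inv =
    let t₁ , s₁ , run₁ , t₁≤ , frame₁ , inv₁ =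
          round q φ σ ρ b (fromℕ< i<n) s (subst (λ i → Round σ ρ b q _ i s) (sym (toℕ-fromℕ< i<n)) inv)
        t₂ , s₂ , run₂ , t₂≤ , frame₂ , answer =
          iterate q φ σ ρ b k (suc i) s₁ 1+i+k≡n
            (subst (λ i → Round σ ρ b q _ (suc i) s₁) (toℕ-fromℕ< i<n) inv₁)
    in _ , s₂ , while-do guard run₁ run₂ , bound t₁≤ t₂≤ , Frame-trans frame₁ frame₂ , answer
    where
    1+i+k≡n : suc i + k ≡ n
    1+i+k≡n = trans (sym (ℕ.+-suc i k)) i+1+k≡n
    i<n : i < n
    i<n = ℕ.m+n≤o⇒m≤o (suc i) (ℕ.≤-reflexive 1+i+k≡n)
    guard : regs s 0 ∸ regs s (1 + b) ≢ 0
    guard = ℕ.>⇒≢ (subst (0 <_) (sym (cong₂ _∸_ (order (Round.env inv)) (Round.index inv)))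
                         (ℕ.m<n⇒0<n∸m i<n))
    bound : ∀ {t₁ t₂} → t₁ ≤ time φ n + 16 → t₂ ≤ k * (4 + (time φ n + 16)) + 4 →
            4 + (t₁ + t₂) ≤ suc k * (4 + (time φ n + 16)) + 4
    bound {t₁} {t₂} t₁≤ t₂≤ = begin
      4 + (t₁ + t₂)
        ≤⟨ ℕ.+-monoʳ-≤ 4 (ℕ.+-mono-≤ t₁≤ t₂≤) ⟩
      4 + ((time φ n + 16) + (k * (4 + (time φ n + 16)) + 4))
        ≡⟨ ℕ.+-assoc (4 + (time φ n + 16)) _ 4 ⟨
      suc k * (4 + (time φ n + 16)) + 4 ∎
      where open ℕ.≤-Reasoning

-- Polynomial time

-- A monomial in `suc n` is enough: its base is positive, so exponents can be raised, which keeps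
-- sums in this form.
Polynomial : (ℕ → ℕ) → Set
Polynomial f = ∃₂ λ a d → ∀ n → f n ≤ a * suc n ^ d

poly-const : ∀ c → Polynomial λ _ → c
poly-const c = c , 0 , λ _ → ℕ.≤-reflexive (sym (ℕ.*-identityʳ c))

poly-id : Polynomial λ n → n
poly-id = 1 , 1 , λ n → ℕ.≤-trans (ℕ.n≤1+n n)
  (ℕ.≤-reflexive (sym (trans (ℕ.*-identityˡ _) (ℕ.*-identityʳ (suc n)))))

poly-+ : ∀ {f g} → Polynomial f → Polynomial g → Polynomial λ n → f n + g n
poly-+ {f} {g} (a , d , f≤) (b , e , g≤) = a + b , d + e , λ n → begin
  f n + g n
    ≤⟨ ℕ.+-mono-≤ (f≤ n) (g≤ n) ⟩
  a * suc n ^ d + b * suc n ^ e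
    ≤⟨ ℕ.+-mono-≤ (ℕ.*-monoʳ-≤ a (ℕ.^-monoʳ-≤ (suc n) (ℕ.m≤m+n d e)))
                  (ℕ.*-monoʳ-≤ b (ℕ.^-monoʳ-≤ (suc n) (ℕ.m≤n+m e d))) ⟩
  a * suc n ^ (d + e) + b * suc n ^ (d + e)
    ≡⟨ ℕ.*-distribʳ-+ (suc n ^ (d + e)) a b ⟨
  (a + b) * suc n ^ (d + e) ∎
  where open ℕ.≤-Reasoning

poly-* : ∀ {f g} → Polynomial f → Polynomial g → Polynomial λ n → f n * g n
poly-* {f} {g} (a , d , f≤) (b , e , g≤) = a * b , d + e , λ n → begin
  f n * g n
    ≤⟨ ℕ.*-mono-≤ (f≤ n) (g≤ n) ⟩
  (a * suc n ^ d) * (b * suc n ^ e)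
    ≡⟨ ℕ.[m*n]*[o*p]≡[m*o]*[n*p] a (suc n ^ d) b (suc n ^ e) ⟩
  (a * b) * (suc n ^ d * suc n ^ e)
    ≡⟨ cong (a * b *_) (ℕ.^-distribˡ-+-* (suc n) d e) ⟨
  (a * b) * suc n ^ (d + e) ∎
  where open ℕ.≤-Reasoning

time-polynomial : (φ : Formula m) → Polynomial (time φ)
time-polynomial (i ≐ j)     = poly-const 10
time-polynomial (i ~ j)     = poly-const 5
time-polynomial (neg φ)     = poly-+ (time-polynomial φ) (poly-const 4)
time-polynomial (bin o φ ψ) =
  poly-+ (time-polynomial φ) (poly-+ (time-polynomial ψ) (poly-const 8))
time-polynomial (quant q φ) =
  poly-+ (poly-const 6)
    (poly-+ (poly-* poly-id (poly-+ (poly-const 4) (poly-+ (time-polynomial φ) (poly-const 16))))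
            (poly-const 4))

-- The criterion as a formula and the decision program

_∈Nᶠ_ : Fin m → Fin m → Formula m
x ∈Nᶠ v = bin or (x ≐ v) (v ~ x)

pickedᶠ : (w z v : Fin m) → Formula m
pickedᶠ w z v = bin and (v ∈Nᶠ w) (neg (v ≐ z))

sameSideᶠ : (w z y x : Fin m) → Formula m
sameSideᶠ w z y x = bin and (bin imp (pickedᶠ w z y) (pickedᶠ w z x))
                            (bin imp (pickedᶠ w z x) (pickedᶠ w z y))

-- Outside the innermost quantifier, x and v have the indices 0 and 1.
colorable-2ᶠ : Formula 0
colorable-2ᶠ =
  quant some (quant some (quant all (quant some
    (bin and (zero ∈Nᶠ suc zero)
             (quant all (bin imp (y ∈Nᶠ v) (bin imp (sameSideᶠ w z y x) (y ≐ x))))))))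
  where
  y x v z w : Fin 5
  y = zero
  x = suc zero
  v = suc (suc zero)
  z = suc (suc (suc zero))
  w = suc (suc (suc (suc zero)))

-- The tests single out k < 0, k ≥ 3 and k = 2 in turn. The last line answers k = 0 and k = 1
-- together: k ∸ (n ∸ 1) is 0 for k = 0, and for k = 1 and n ≥ 1 it is 1 exactly if n = 1.
decideColorability : Cmd
decideColorability =
  if≢0 reg 1 then 0 ≔ num 0 else
  if≢0 reg 2 ⊖ num 2 then 0 ≔ num 1 else
  if≢0 reg 2 ⊖ num 1 then (compile colorable-2ᶠ [] 3 ⨾ 0 ≔ reg 3) else
  (0 ≔ reg 2 ⊖ (reg 0 ⊖ num 1))

decideColorability-correct : ∀ (G : Graph n) → IsConnected G → IsSplit G → ∀ k →
  Runs decideColorability ⟪ inputRegs n k , adjacencyMatrix G ⟫ (time colorable-2ᶠ n + 16)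
    λ s → Answer (CFCNColorable G k) (regs s 0)
decideColorability-correct {n} G conn@(0<n , _) (K , clique , indep) = decide
  where
  open Split G K clique indep

  -- 16 is the cost for k = 0 and k = 1, the longest path that does not evaluate the formula.
  fits : ∀ c → c ≤ 16 → c ≤ time colorable-2ᶠ n + 16
  fits c c≤16 = ℕ.≤-trans c≤16 (ℕ.m≤n+m 16 (time colorable-2ᶠ n))

  decide-1 : 0 < n → Answer (CFCNColorable G (+ 1)) (1 ∸ (n ∸ 1))
  decide-1 0<n with ℕ.m≤n⇒m<n∨m≡n 0<n
  ... | inj₁ 1<n = false , ℕ.m≤n⇒m∸n≡0 (ℕ.m<n⇒0<n∸m 1<n) ,
                   ofⁿ (¬Colorable-1 G conn 1<n ∘ CFCNColorable⇒Colorable G)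
  ... | inj₂ refl = true , refl , ofʸ (Colorable⇒CFCNColorable G (Colorable-1-trivial G))

  decide : ∀ k → Runs decideColorability ⟪ inputRegs n k , adjacencyMatrix G ⟫
                   (time colorable-2ᶠ n + 16) λ s → Answer (CFCNColorable G k) (regs s 0)
  decide -[1+ k ] =
    _ , _ , if-then (λ ()) assign , fits 4 (ℕ.m≤m+n 4 12) ,
    false , refl , ofⁿ (¬CFCNColorable-negative G 0<n)
  decide (+ 0) =
    _ , _ , if-else refl (if-else refl (if-else refl assign)) , fits 16 ℕ.≤-refl ,
    false , ℕ.0∸n≡0 (n ∸ 1) , ofⁿ (¬Colorable-0 G 0<n ∘ CFCNColorable⇒Colorable G)
  decide (+ 1) =
    _ , _ , if-else refl (if-else refl (if-else refl assign)) , fits 16 ℕ.≤-refl ,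
    decide-1 0<n
  decide (+ 2) =
    let t , s , run , t≤ , _ , a , reg≡ , reflects =
          compile-correct G colorable-2ᶠ [] [] 3 _ (record
            { matrix = refl ; 0<b = s≤s z≤n ; order = refl
            ; below = λ () ; var = λ () ; n*var = λ () })
    in _ , _ , if-else refl (if-else refl (if-then (λ ()) (seq run assign))) ,
       bound t≤ ,
       -- The meaning of `colorable-2ᶠ` unfolds to the existence of w and z with
       -- `ConflictFree G (SameSide G w z)`, so the criterion applies directly.
       a , reg≡ , Reflects-map
         (λ (w , z , cf) → Colorable⇒CFCNColorable G (SameSide⇒Colorable-2 G w z cf))
         (Colorable-2⇒SameSide conn ∘ CFCNColorable⇒Colorable G) reflects
    where
    bound : ∀ {t} → t ≤ time colorable-2ᶠ n → 2 + (4 + (4 + (t + 2))) ≤ time colorable-2ᶠ n + 16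
    bound {t} t≤ = begin
      10 + (t + 2)               ≡⟨ ℕ.+-comm 10 (t + 2) ⟩
      t + 2 + 10                 ≡⟨ ℕ.+-assoc t 2 10 ⟩
      t + 12                     ≤⟨ ℕ.+-mono-≤ t≤ (ℕ.m≤m+n 12 4) ⟩
      time colorable-2ᶠ n + 16   ∎
      where open ℕ.≤-Reasoning
  decide (+ suc (suc (suc k))) =
    _ , _ , if-else refl (if-then (λ ()) assign) , fits 8 (ℕ.m≤m+n 8 8) ,
    true , refl , ofʸ (Colorable⇒CFCNColorable G (Colorable-mono G (ℕ.m≤m+n 3 k) (colorable-3 0<n)))

-- Compares `suc n`, in which running times are bounded, with the size of an instance, where m is
-- the binary length of k.
1+n≤n*n+1+m : ∀ n m → suc n ≤ n * n + suc m
1+n≤n*n+1+m n m = begin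
  suc n         ≡⟨ ℕ.+-comm 1 n ⟩
  n + 1         ≤⟨ ℕ.+-mono-≤ (n≤n*n n) (s≤s z≤n) ⟩
  n * n + suc m ∎
  where
  open ℕ.≤-Reasoning
  n≤n*n : ∀ n → n ≤ n * n
  n≤n*n zero    = z≤n
  n≤n*n (suc n) = ℕ.m≤m*n (suc n) (suc n)

theorem3 : PolyTimeSolvable (CFCNColoring (λ G → IsConnected G × IsSplit G))
theorem3 = decideColorability , a , d , 0 , λ ((n , G) , k) (conn , split) →
  let t , s , run , t≤ , answer , reg≡ , reflects = decideColorability-correct G conn split k
  in t , s , answer , run , ℕ.≤-trans t≤ (within n _) , reg≡ , reflects
  where
  bound : Polynomial λ n → time colorable-2ᶠ n + 16
  bound = poly-+ (time-polynomial colorable-2ᶠ) (poly-const 16)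

  a = proj₁ bound
  d = proj₁ (proj₂ bound)

  within : ∀ n m → time colorable-2ᶠ n + 16 ≤ a * (n * n + suc m) ^ d + 0
  within n m = begin
    time colorable-2ᶠ n + 16    ≤⟨ proj₂ (proj₂ bound) n ⟩
    a * suc n ^ d               ≤⟨ ℕ.*-monoʳ-≤ a (ℕ.^-monoˡ-≤ d (1+n≤n*n+1+m n m)) ⟩
    a * (n * n + suc m) ^ d     ≡⟨ ℕ.+-identityʳ _ ⟨
    a * (n * n + suc m) ^ d + 0 ∎
    where open ℕ.≤-Reasoning
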